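{- $P(4)=9$. That is, every maximum $4\times 4$ valid board has nine prisoners.
   Context: A configuration on an $n\times n$ board assigns to each of the $n^2$ squares exactly one occupant, either a prisoner or a guard. Two distinct squares are adjacent if one is directly above, below, to the left, to the right, or diagonal to the other (king-move adjacency). A configuration is valid (a valid board) if every square occupied by a prisoner is adjacent to at least as many squares occupied by guards as squares occupied by (other) prisoners. A maximum configuration (maximum board) is a valid board that has the greatest number of prisoners among all valid boards on the $n\times n$ board. $P(n)$ denotes the number of prisoners in a maximum configuration on the $n\times n$ board. -}

module Defs where

open import Data.Fin using (Fin; toℕ)
import Data.Fin.Properties as Fin
open import Data.List using (List; []; _∷_; [_]; length; filter; allFin; cartesianProduct; cartesianProductWith)
open import Data.List.Extrema.Nat using (argmax; argmax-all; f[xs]≤f[argmax])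
open import Data.List.Membership.Propositional using (_∈_)
open import Data.List.Membership.Propositional.Properties using (∈-cartesianProductWith⁺; ∈-filter⁺)
open import Data.List.Relation.Unary.All as All using ()
open import Data.List.Relation.Unary.All.Properties using (all-filter)
open import Data.List.Relation.Unary.Any using (here; there)
open import Data.Nat using (ℕ; zero; suc; _≤_; _≤?_; ∣_-_∣)
open import Data.Product using (_×_; _,_; Σ-syntax; proj₁)
open import Data.Product.Properties using (≡-dec)
open import Data.Vec using (Vec; []; _∷_; lookup; replicate)
open import Data.Vec.Properties using (lookup-replicate)
open import Relation.Binary.Definitions using (DecidableEquality)
open import Relation.Binary.PropositionalEquality using (_≡_; _≢_; refl; sym; trans; cong)
open import Relation.Nullary using (Dec; yes; no; ¬?; contradiction)
open import Relation.Nullary.Decidable using (_×-dec_; _→-dec_; map′)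

data Occupant : Set where
  prisoner guard : Occupant

infix 4 _≟ᵒ_

_≟ᵒ_ : DecidableEquality Occupant
prisoner ≟ᵒ prisoner = yes refl
prisoner ≟ᵒ guard    = no λ ()
guard    ≟ᵒ prisoner = no λ ()
guard    ≟ᵒ guard    = yes refl

-- (row , column)
Square : ℕ → Set
Square n = Fin n × Fin n

squares : ∀ n → List (Square n)
squares n = cartesianProduct (allFin n) (allFin n)

Configuration : ℕ → Set
Configuration n = Vec (Vec Occupant n) n

occupant : ∀ {n} → Configuration n → Square n → Occupant
occupant c (i , j) = lookup (lookup c i) j

-- King moves: distinct squares whose rows and columns each differ by at
-- most one.
Adjacent : ∀ {n} → Square n → Square n → Set
Adjacent s@(i , j) t@(k , l) =
  s ≢ t × ∣ toℕ i - toℕ k ∣ ≤ 1 × ∣ toℕ j - toℕ l ∣ ≤ 1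

adjacent? : ∀ {n} (s t : Square n) → Dec (Adjacent s t)
adjacent? s@(i , j) t@(k , l) =
  ¬? (≡-dec Fin._≟_ Fin._≟_ s t)
    ×-dec (∣ toℕ i - toℕ k ∣ ≤? 1)
    ×-dec (∣ toℕ j - toℕ l ∣ ≤? 1)

#adjacent : ∀ {n} → Occupant → Configuration n → Square n → ℕ
#adjacent {n} o c s =
  length (filter (λ t → adjacent? s t ×-dec occupant c t ≟ᵒ o) (squares n))

#prisoners : ∀ {n} → Configuration n → ℕ
#prisoners {n} c = length (filter (λ s → occupant c s ≟ᵒ prisoner) (squares n))

Valid : ∀ {n} → Configuration n → Set
Valid {n} c = (s : Square n) → occupant c s ≡ prisoner →
              #adjacent prisoner c s ≤ #adjacent guard c s

Maximum : ∀ {n} → Configuration n → Set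
Maximum {n} c =
  Valid c × ((d : Configuration n) → Valid d → #prisoners d ≤ #prisoners c)

valid? : ∀ {n} (c : Configuration n) → Dec (Valid c)
valid? c = map′ (λ v (i , j) → v i j) (λ v i j → v (i , j))
  (Fin.all? λ i → Fin.all? λ j →
    (occupant c (i , j) ≟ᵒ prisoner)
      →-dec (#adjacent prisoner c (i , j) ≤? #adjacent guard c (i , j)))

vectors : ∀ {A : Set} → List A → ∀ n → List (Vec A n)
vectors xs zero    = [ [] ]
vectors xs (suc n) = cartesianProductWith _∷_ xs (vectors xs n)

∈-vectors : ∀ {A : Set} {xs : List A} → (∀ x → x ∈ xs) →
            ∀ {n} (v : Vec A n) → v ∈ vectors xs n
∈-vectors all []      = here refl
∈-vectors all (x ∷ v) = ∈-cartesianProductWith⁺ _∷_ (all x) (∈-vectors all v)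

configurations : ∀ n → List (Configuration n)
configurations n = vectors (vectors (prisoner ∷ guard ∷ []) n) n

∈-configurations : ∀ {n} (c : Configuration n) → c ∈ configurations n
∈-configurations = ∈-vectors (∈-vectors λ { prisoner → here refl ; guard → there (here refl) })

allGuards : ∀ n → Configuration n
allGuards n = replicate n (replicate n guard)

allGuards-valid : ∀ n → Valid (allGuards n)
allGuards-valid n (i , j) p = contradiction (trans (sym isGuard) p) λ ()
  where
  isGuard : occupant (allGuards n) (i , j) ≡ guard
  isGuard = trans (cong (λ r → lookup r j) (lookup-replicate i (replicate n guard)))
                  (lookup-replicate j guard)

maximumConfiguration : ∀ n → Σ[ c ∈ Configuration n ] Maximum c
maximumConfiguration n =
  argmax #prisoners (allGuards n) valids ,
  argmax-all #prisoners (allGuards-valid n) (all-filter valid? (configurations n)) ,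
  λ d v → All.lookup (f[xs]≤f[argmax] (allGuards n) valids)
                     (∈-filter⁺ valid? (∈-configurations d) v)
  where
  valids : List (Configuration n)
  valids = filter valid? (configurations n)

-- Independent of the maximum configuration chosen: by Maximum, any two have
-- equally many prisoners.
P : ℕ → ℕ
P n = #prisoners (proj₁ (maximumConfiguration n))

{-# OPTIONS --safe #-}
-- A half board (an outer and an inner row) whose outer prisoners are satisfied
-- holds at most four prisoners, except for two mirror-image halves holding
-- five.  Whether the outer row is satisfied does not depend on the other half,
-- so this is a check of 256 cases.  A board with ten prisoners would consist of
-- two exceptional halves, and none of the four such boards is valid.
module Submission where

open import Defs
open import Data.Fin using (Fin; #_)
import Data.Fin.Properties as Fin
open import Data.List using (List; []; _∷_; _++_; length; filter; allFin; cartesianProduct)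
open import Data.List.Membership.Propositional using (_∈_)
open import Data.List.Membership.Propositional.Properties using (∈-cartesianProduct⁺)
open import Data.List.Properties using (filter-++; length-++)
open import Data.List.Relation.Unary.All as All using (All)
open import Data.List.Relation.Unary.Any using (here; there; any?)
open import Data.Nat using (ℕ; _+_; _≤_; _≤?_)
open import Data.Nat.Properties using (≤-antisym; m≤n⇒m≤1+n; +-mono-≤; module ≤-Reasoning)
open import Data.Product using (_×_; _,_; proj₁; proj₂)
open import Data.Product.Properties using (≡-dec)
open import Data.Sum using (_⊎_; inj₁; inj₂)
open import Data.Vec using (Vec; []; _∷_)
import Data.Vec.Properties as Vec
open import Relation.Binary.PropositionalEquality using (_≡_; refl; cong; trans)
open import Relation.Nullary using (Dec; ¬_; ¬?; contradiction)
open import Relation.Nullary.Decidable using (_→-dec_; _×-dec_; _⊎-dec_; toWitness)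

#prisonersIn : ∀ {n} → Configuration n → List (Square n) → ℕ
#prisonersIn c ss = length (filter (λ s → occupant c s ≟ᵒ prisoner) ss)

#prisonersIn-++ : ∀ {n} (c : Configuration n) ss ts →
                  #prisonersIn c (ss ++ ts) ≡ #prisonersIn c ss + #prisonersIn c ts
#prisonersIn-++ c ss ts =
  trans (cong length (filter-++ (λ s → occupant c s ≟ᵒ prisoner) ss ts))
        (length-++ (filter (λ s → occupant c s ≟ᵒ prisoner) ss))

ValidRow : ∀ {n} → Configuration n → Fin n → Set
ValidRow c i = ∀ j → occupant c (i , j) ≡ prisoner →
               #adjacent prisoner c (i , j) ≤ #adjacent guard c (i , j)

validRow? : ∀ {n} (c : Configuration n) i → Dec (ValidRow c i)
validRow? c i = Fin.all? λ j →
  (occupant c (i , j) ≟ᵒ prisoner)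
    →-dec (#adjacent prisoner c (i , j) ≤? #adjacent guard c (i , j))

Row : Set
Row = Vec Occupant 4

-- (outer row , inner row)
Half : Set
Half = Row × Row

-- The second half is flipped, so both halves list their outer row first and one list of exceptions
-- serves top and bottom.
board : Half → Half → Configuration 4
board (o , i) (o′ , i′) = o ∷ i ∷ i′ ∷ o′ ∷ []

occupants : List Occupant
occupants = prisoner ∷ guard ∷ []

∈-occupants : ∀ o → o ∈ occupants
∈-occupants prisoner = here refl
∈-occupants guard    = there (here refl)

halves : List Half
halves = cartesianProduct (vectors occupants 4) (vectors occupants 4)

∈-halves : ∀ h → h ∈ halves
∈-halves (o , i) =
  ∈-cartesianProduct⁺ (∈-vectors ∈-occupants o) (∈-vectors ∈-occupants i)

exceptional : List Half
exceptional =
  ( guard    ∷ prisoner ∷ guard ∷ prisoner ∷ []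
  , prisoner ∷ prisoner ∷ guard ∷ prisoner ∷ []) ∷
  ( prisoner ∷ guard ∷ prisoner ∷ guard    ∷ []
  , prisoner ∷ guard ∷ prisoner ∷ prisoner ∷ []) ∷ []

-- The count is a parameter because the same half is counted on different squares at the top and at
-- the bottom.
HalfBound : Half → ℕ → Set
HalfBound h k = k ≤ 4 ⊎ (h ∈ exceptional × k ≤ 5)

halfBound? : ∀ h k → Dec (HalfBound h k)
halfBound? h k = (k ≤? 4) ⊎-dec (any? (h ≟ʰ_) exceptional ×-dec (k ≤? 5))
  where
  _≟ʳ_ = Vec.≡-dec _≟ᵒ_
  _≟ʰ_ = ≡-dec _≟ʳ_ _≟ʳ_

topSquares bottomSquares : List (Square 4)
topSquares    = cartesianProduct (# 0 ∷ # 1 ∷ []) (allFin 4)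
bottomSquares = cartesianProduct (# 2 ∷ # 3 ∷ []) (allFin 4)

-- The check evaluates with `h′` a variable: every neighbour of an outer square lies in `h`, and
-- `#adjacent` tests adjacency before it looks at an occupant.
top-bound : ∀ h h′ → ValidRow (board h h′) (# 0) →
            HalfBound h (#prisonersIn (board h h′) topSquares)
top-bound h h′ = All.lookup (toWitness {a? = check} _) (∈-halves h)
  where
  check : Dec (All (λ h → ValidRow (board h h′) (# 0) →
                          HalfBound h (#prisonersIn (board h h′) topSquares)) halves)
  check = All.all? (λ h → validRow? (board h h′) (# 0) →-dec halfBound? h _) halves

bottom-bound : ∀ h h′ → ValidRow (board h h′) (# 3) →
               HalfBound h′ (#prisonersIn (board h h′) bottomSquares)
bottom-bound h h′ = All.lookup (toWitness {a? = check} _) (∈-halves h′)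
  where
  check : Dec (All (λ h′ → ValidRow (board h h′) (# 3) →
                           HalfBound h′ (#prisonersIn (board h h′) bottomSquares)) halves)
  check = All.all? (λ h′ → validRow? (board h h′) (# 3) →-dec halfBound? h′ _) halves

-- Both exceptional inner rows have prisoners at both ends. In the inner row of `h`, the end
-- prisoner beside another prisoner thus has three prisoners among its five neighbours: that one,
-- one diagonally in the outer row, and the one facing it in `h′`.
exceptional-invalid : ∀ {h h′} → h ∈ exceptional → h′ ∈ exceptional → ¬ Valid (board h h′)
exceptional-invalid h∈ h′∈ = All.lookup (All.lookup (toWitness {a? = check} _) h∈) h′∈
  where
  check : Dec (All (λ h → All (λ h′ → ¬ Valid (board h h′)) exceptional) exceptional)
  check = All.all? (λ h → All.all? (λ h′ → ¬? (valid? (board h h′))) exceptional) exceptional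

valid⇒≤9 : (c : Configuration 4) → Valid c → #prisoners c ≤ 9
valid⇒≤9 (o ∷ i ∷ i′ ∷ o′ ∷ []) v = begin
  -- `squares 4` evaluates to this concatenation.
  #prisonersIn c (topSquares ++ bottomSquares)
    ≡⟨ #prisonersIn-++ c topSquares bottomSquares ⟩
  #prisonersIn c topSquares + #prisonersIn c bottomSquares
    ≤⟨ add (top-bound h h′ (λ j → v (# 0 , j))) (bottom-bound h h′ (λ j → v (# 3 , j))) ⟩
  9 ∎
  where
  open ≤-Reasoning
  h h′ : Half
  h  = o , i
  h′ = o′ , i′
  c : Configuration 4
  c = board h h′
  add : ∀ {k l} → HalfBound h k → HalfBound h′ l → k + l ≤ 9
  add (inj₁ k≤4)       (inj₁ l≤4)        = +-mono-≤ k≤4 (m≤n⇒m≤1+n l≤4)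
  add (inj₁ k≤4)       (inj₂ (_ , l≤5))  = +-mono-≤ k≤4 l≤5
  add (inj₂ (_ , k≤5)) (inj₁ l≤4)        = +-mono-≤ k≤5 l≤4
  -- The one case that uses validity on the inner rows.
  add (inj₂ (h∈ , _))  (inj₂ (h′∈ , _))  = contradiction v (exceptional-invalid h∈ h′∈)

-- An exceptional top half gives five prisoners; a row of guards then allows a full outer row of
-- four below it.
ninePrisoners : Configuration 4
ninePrisoners =
  (guard    ∷ prisoner ∷ guard    ∷ prisoner ∷ []) ∷
  (prisoner ∷ prisoner ∷ guard    ∷ prisoner ∷ []) ∷
  (guard    ∷ guard    ∷ guard    ∷ guard    ∷ []) ∷
  (prisoner ∷ prisoner ∷ prisoner ∷ prisoner ∷ []) ∷ []

ninePrisoners-valid : Valid ninePrisoners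
ninePrisoners-valid = toWitness {a? = valid? ninePrisoners} _

maximum⇒9 : (c : Configuration 4) → Maximum c → #prisoners c ≡ 9
maximum⇒9 c (v , max) = ≤-antisym (valid⇒≤9 c v) (max ninePrisoners ninePrisoners-valid)

-- Stated for a variable n: at n = 4 the type checker could evaluate P by
-- enumerating all configurations.
P-≡ : ∀ n {k} → ((c : Configuration n) → Maximum c → #prisoners c ≡ k) → P n ≡ k
P-≡ n all≡k = all≡k (proj₁ (maximumConfiguration n)) (proj₂ (maximumConfiguration n))

proposition2p4 : P 4 ≡ 9 × ((c : Configuration 4) → Maximum c → #prisoners c ≡ 9)
proposition2p4 = P-≡ 4 maximum⇒9 , maximum⇒9
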